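{- Let $\varepsilon>0$. Assuming $(1+\varepsilon)$-multiplicative approximation queries, any algorithm requires at least $n\cdot\frac{\varepsilon}{4}$ queries to detect the target $t$. (This is a worst-case lower bound: there is a graph $G$ with $n$ vertices such that, for every algorithm that detects the unknown target in $G$, some position of the target and some valid, adversarially chosen $(1+\varepsilon)$-multiplicative approximation query responses force the algorithm to make at least $n\cdot\frac{\varepsilon}{4}$ queries.)
   Context: Graphs $G=(V,E)$ with $|V|=n$ are connected, simple and undirected, and are given along with a weight function $w:E\to\mathbb{R}^+$ on the edges (the graph is unweighted if all weights are $1$). The distance $d(v,u)$ is the length of a shortest path between $v$ and $u$ with respect to $w$, and $N(v)$ is the set of vertices adjacent to $v$. There is one initially unknown target vertex $t\in V$, which the algorithm must detect by querying vertices. A $(1+\varepsilon)$-multiplicative approximation query at a vertex $v\in V$ returns a (possibly adversarially chosen) neighbor $u\in N(v)$ such that $w(vu)+d(u,t)\le(1+\varepsilon)\cdot d(v,t)$; if the queried vertex $v$ equals $t$, this is revealed by the query.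
   Formalization: The bound is stated for n·ε/4 ≤ n−1 only; otherwise it is false, since querying n−1 vertices always detects t (the last one by elimination), e.g. n = 2, ε = 5. -}

module Defs where

open import Level using (Level; suc; _⊔_; 0ℓ)
open import Algebra.Core using (Op₁; Op₂)
open import Algebra.Bundles using (CommutativeRing)
open import Algebra.Structures using (IsCommutativeRing)
import Algebra.Definitions.RawMonoid as RawMonoidMult
open import Data.Fin using (Fin)
open import Data.List using (List; []; _∷_)
open import Data.List.Relation.Unary.Unique.Propositional using (Unique)
open import Data.Nat using (ℕ)
open import Data.Product using (Σ-syntax; ∃-syntax; _×_; _,_)
open import Relation.Binary.Core using (Rel)
open import Relation.Binary.Definitions using (Decidable; Symmetric; Irreflexive)
open import Relation.Binary.PropositionalEquality using (_≡_; _≢_)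
open import Relation.Binary.Structures using (IsTotalOrder)
open import Relation.Nullary using (¬_)

private
  variable
    c ℓ₁ ℓ₂ : Level

-- Linearly ordered fields stand in for ℝ, which is one of them classically.
record OrderedField c ℓ₁ ℓ₂ : Set (suc (c ⊔ ℓ₁ ⊔ ℓ₂)) where
  infix  8 _⁻¹ -_
  infixl 7 _*_ _/_
  infixl 6 _+_ _-_
  infix  4 _≈_ _≤_ _<_
  field
    Carrier           : Set c
    _≈_               : Rel Carrier ℓ₁
    _≤_               : Rel Carrier ℓ₂
    _+_ _*_           : Op₂ Carrier
    -_                : Op₁ Carrier
    _⁻¹               : Op₁ Carrier  -- total; unconstrained at 0#, apart from ⁻¹-cong
    0# 1#             : Carrier
    isCommutativeRing : IsCommutativeRing _≈_ _+_ _*_ -_ 0# 1#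
    0≉1               : ¬ 0# ≈ 1#
    ⁻¹-cong           : ∀ {x y} → x ≈ y → x ⁻¹ ≈ y ⁻¹
    *-inverseʳ        : ∀ x → ¬ x ≈ 0# → x * x ⁻¹ ≈ 1#
    isTotalOrder      : IsTotalOrder _≈_ _≤_
    +-mono-≤          : ∀ {x y u v} → x ≤ y → u ≤ v → x + u ≤ y + v
    *-nonNeg          : ∀ {x y} → 0# ≤ x → 0# ≤ y → 0# ≤ x * y

  commutativeRing : CommutativeRing c ℓ₁
  commutativeRing = record { isCommutativeRing = isCommutativeRing }

  _<_ : Rel Carrier (ℓ₁ ⊔ ℓ₂)
  x < y = x ≤ y × ¬ x ≈ y

  _-_ _/_ : Op₂ Carrier
  x - y = x + - y
  x / y = x * y ⁻¹

  fromℕ : ℕ → Carrier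
  fromℕ n = n ·ℕ 1#
    where open RawMonoidMult (CommutativeRing.+-rawMonoid commutativeRing)
            renaming (_×_ to _·ℕ_)

data Walk {n : ℕ} (Adj : Rel (Fin n) 0ℓ) : Rel (Fin n) 0ℓ where
  stop : ∀ {v} → Walk Adj v v
  step : ∀ {v x} u → Adj v u → Walk Adj u x → Walk Adj v x

vertices : ∀ {n} {Adj : Rel (Fin n) 0ℓ} {v u} → Walk Adj v u → List (Fin n)
vertices {v = v} stop         = v ∷ []
vertices {v = v} (step _ _ p) = v ∷ vertices p

module _ (F : OrderedField c ℓ₁ ℓ₂) where
  open OrderedField F

  record Graph (n : ℕ) : Set (suc 0ℓ ⊔ c ⊔ ℓ₁ ⊔ ℓ₂) where
    field
      Adj        : Rel (Fin n) 0ℓ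
      adj?       : Decidable Adj
      adj-sym    : Symmetric Adj
      adj-irrefl : Irreflexive _≡_ Adj
      connected  : ∀ v u → Walk Adj v u
      -- Only the values on adjacent pairs matter.
      weight     : Fin n → Fin n → Carrier
      weight-sym : ∀ {v u} → Adj v u → weight v u ≈ weight u v
      weight-pos : ∀ {v u} → Adj v u → 0# < weight v u

    len : ∀ {v u} → Walk Adj v u → Carrier
    len stop                 = 0#
    len {v = v} (step u _ p) = weight v u + len p

    Path : Rel (Fin n) 0ℓ
    Path v u = Σ[ p ∈ Walk Adj v u ] Unique (vertices p)

    pathLength : ∀ {v u} → Path v u → Carrier
    pathLength (p , _) = len p

    IsDistance : Fin n → Fin n → Carrier → Set (ℓ₁ ⊔ ℓ₂)
    IsDistance v u d =
      (∃[ p ] pathLength {v} {u} p ≈ d) × (∀ (p : Path v u) → d ≤ pathLength p)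

data Answer (n : ℕ) : Set where
  isTarget : Answer n
  toward   : Fin n → Answer n

data Action (n : ℕ) : Set where
  query    : Fin n → Action n
  announce : Fin n → Action n

-- The answers received so far, most recent first.  A deterministic algorithm
-- can recompute the vertices it queried from them.
History : ℕ → Set
History n = List (Answer n)

Algorithm : ℕ → Set
Algorithm n = History n → Action n

module _ (F : OrderedField c ℓ₁ ℓ₂) {n : ℕ} (G : Graph F n)
         (ε : OrderedField.Carrier F) where
  open OrderedField F
  open Graph G

  data Legal (t : Fin n) : Fin n → Answer n → Set (c ⊔ ℓ₁ ⊔ ℓ₂) where
    isTarget : Legal t t isTarget
    toward   : ∀ {v u dᵤ dᵥ} → v ≢ t → Adj v u →
               IsDistance u t dᵤ → IsDistance v t dᵥ →
               weight v u + dᵤ ≤ (1# + ε) * dᵥ →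
               Legal t v (toward u)

  module _ (alg : Algorithm n) where

    -- Histories that can arise when the target is t.
    data Reachable (t : Fin n) : History n → Set (c ⊔ ℓ₁ ⊔ ℓ₂) where
      []  : Reachable t []
      ask : ∀ {h v a} → Reachable t h → alg h ≡ query v → Legal t v a →
            Reachable t (a ∷ h)

    -- From history h on, whatever legal answers are given, the algorithm
    -- stops after finitely many queries and announces t.
    data DetectsFrom (t : Fin n) (h : History n) : Set (c ⊔ ℓ₁ ⊔ ℓ₂) where
      done : alg h ≡ announce t → DetectsFrom t h
      ask  : ∀ {v} → alg h ≡ query v →
             (∀ a → Legal t v a → DetectsFrom t (a ∷ h)) → DetectsFrom t h

    Detects : Set (c ⊔ ℓ₁ ⊔ ℓ₂)
    Detects = ∀ t → DetectsFrom t []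

{-# OPTIONS --safe #-}
module Submission where

-- The graph is a star on n vertices whose centre has one leaf, the decoy, at
-- distance ε, and all its other leaves at distance 2.  The adversary follows a
-- fixed rule that does not look at the target: the centre points to the decoy,
-- and every leaf points to the centre.  These answers are legal for every
-- target other than the queried vertex (reply-legal).  A leaf has no other
-- neighbour, so its answer is exact.  So is that of the centre when the target
-- is the decoy.  When the target is another leaf, the centre is at distance 2
-- from it, and the detour through the decoy has length ε + (ε + 2) = (1 + ε) · 2.
--
-- Hence an answer only tells that the queried vertex is not the target.  As long
-- as two vertices have not been queried, both are possible targets with the same
-- history, and the algorithm cannot announce anything.  So it makes at least
-- n - 1 queries against some target (oblivious-adversary), and
-- n · (ε / 4) ≤ n - 1 by hypothesis.

open import Defs
open import Algebra.Bundles using (CommutativeRing)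
import Algebra.Solver.Ring.NaturalCoefficients.Default as SemiringSolver
open import Data.Empty using (⊥-elim)
open import Data.Fin using (Fin; zero; suc; _≟_)
open import Data.Fin.Properties using (any?; injective⇒≤)
open import Data.List using (List; []; _∷_; length)
import Data.List.Membership.DecPropositional as DecMembership
open import Data.List.Membership.Propositional using (_∈_; _∉_)
open import Data.List.Membership.Setoid.Properties using (index-injective)
open import Data.List.Relation.Unary.All using ([]; _∷_)
open import Data.List.Relation.Unary.AllPairs using ([]; _∷_)
open import Data.List.Relation.Unary.Any using (here; there)
open import Data.Nat using (ℕ; zero; suc)
import Data.Nat as ℕ
import Data.Nat.Properties as ℕ
open import Data.Product using (Σ-syntax; ∃-syntax; _×_; _,_; proj₁; proj₂)
open import Data.Sum using (inj₁; inj₂)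
open import Level using (0ℓ)
open import Relation.Binary.Bundles using (Poset)
open import Relation.Binary.Core using (Rel)
open import Relation.Binary.PropositionalEquality as ≡ using (_≡_; _≢_)
import Relation.Binary.Reasoning.PartialOrder as PartialOrderReasoning
open import Relation.Binary.Structures using (IsTotalOrder)
open import Relation.Nullary using (¬_; ¬?; yes; no; contradiction; decidable-stable)

-- Oblivious adversaries

missing-element : ∀ {n} (xs : List (Fin n)) → length xs ℕ.< n → ∃[ x ] x ∉ xs
missing-element {n} xs ∣xs∣<n with any? (λ x → ¬? (DecMembership._∈?_ _≟_ x xs))
... | yes x∉xs = x∉xs
... | no  none = contradiction
  (injective⇒≤ (λ {x} {y} → index-injective (≡.setoid (Fin n)) (all∈ x) (all∈ y)))
  (ℕ.<⇒≱ ∣xs∣<n)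
  where
  all∈ : ∀ x → x ∈ xs
  all∈ x = decidable-stable (DecMembership._∈?_ _≟_ x xs) (λ x∉xs → none (x , x∉xs))

module _ {c ℓ₁ ℓ₂} (F : OrderedField c ℓ₁ ℓ₂) {n : ℕ} (G : Graph F n)
         (ε : OrderedField.Carrier F) (alg : Algorithm n) where

  detects-reachable : ∀ {t h} → DetectsFrom F G ε alg t [] →
                      Reachable F G ε alg t h → DetectsFrom F G ε alg t h
  detects-reachable d [] = d
  detects-reachable d (ask r queries legal) with detects-reachable d r
  ... | done announces = contradiction (≡.trans (≡.sym queries) announces) λ ()
  ... | ask queries′ next with ≡.trans (≡.sym queries) queries′
  ...   | ≡.refl = next _ legal

  -- An algorithm that detects both t and t′ can stop on a history possible for
  -- both only if they coincide.
  queries-if-ambiguous : ∀ {t t′ h} → t ≢ t′ →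
                         DetectsFrom F G ε alg t h → DetectsFrom F G ε alg t′ h →
                         ∃[ v ] alg h ≡ query v
  queries-if-ambiguous _    (ask queries _)  _               = _ , queries
  queries-if-ambiguous _    (done _)         (ask queries _) = _ , queries
  queries-if-ambiguous t≢t′ (done announces) (done announces′)
    with ≡.trans (≡.sym announces) announces′
  ... | ≡.refl = contradiction ≡.refl t≢t′

  -- If the answers reply v are legal for every target other than v, they rule
  -- out only the queried vertices, collected in the list Q.  While k + 1 < n, two
  -- vertices are missing from Q, so a further query must follow.
  oblivious-adversary : (reply : Fin n → Answer n) →
    (∀ {t v} → v ≢ t → Legal F G ε t v (reply v)) → Detects F G ε alg →
    ∀ k → k ℕ.< n →
    ∃[ h ] ∃[ Q ] (length h ≡ k × length Q ≡ k ×
                   (∀ t → t ∉ Q → Reachable F G ε alg t h))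
  oblivious-adversary reply legal detects zero    _    =
    [] , [] , ≡.refl , ≡.refl , λ _ _ → []
  oblivious-adversary reply legal detects (suc k) 1+k<n
    with oblivious-adversary reply legal detects k (ℕ.<-trans (ℕ.n<1+n k) 1+k<n)
  ... | h , Q , ≡.refl , ∣Q∣≡k , reachable =
    reply v ∷ h , v ∷ Q , ≡.refl , ≡.cong suc ∣Q∣≡k ,
    λ t t∉v∷Q → ask (reachable t (λ t∈Q → t∉v∷Q (there t∈Q))) queries
                    (legal (λ v≡t → t∉v∷Q (here (≡.sym v≡t))))
    where
    t₁-missing = missing-element Q
      (≡.subst (ℕ._< n) (≡.sym ∣Q∣≡k) (ℕ.<-trans (ℕ.n<1+n _) 1+k<n))
    t₁   = proj₁ t₁-missing
    t₁∉Q = proj₂ t₁-missing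
    t₂-missing = missing-element (t₁ ∷ Q)
      (≡.subst (ℕ._< n) (≡.cong suc (≡.sym ∣Q∣≡k)) 1+k<n)
    t₂     = proj₁ t₂-missing
    t₂∉t₁Q = proj₂ t₂-missing
    query-next : ∃[ v ] alg h ≡ query v
    query-next = queries-if-ambiguous
      (λ t₁≡t₂ → t₂∉t₁Q (here (≡.sym t₁≡t₂)))
      (detects-reachable (detects t₁) (reachable t₁ t₁∉Q))
      (detects-reachable (detects t₂) (reachable t₂ (λ t₂∈Q → t₂∉t₁Q (there t₂∈Q))))
    v       = proj₁ query-next
    queries = proj₂ query-next

-- Ordered fields

module FieldProperties {c ℓ₁ ℓ₂} (F : OrderedField c ℓ₁ ℓ₂) where
  open OrderedField F
  open CommutativeRing commutativeRing public
    using (ring; commutativeSemiring; +-cong; +-congˡ; +-congʳ; +-comm; +-assoc;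
           +-identityˡ; +-identityʳ; -‿inverseʳ; refl; sym; trans)
  open import Algebra.Properties.Ring ring using (-1*x≈-x; -‿involutive)
  open IsTotalOrder isTotalOrder public
    using (total; antisym)
    renaming (refl to ≤-refl; trans to ≤-trans; reflexive to ≤-reflexive)

  poset : Poset c ℓ₁ ℓ₂
  poset = record { isPartialOrder = IsTotalOrder.isPartialOrder isTotalOrder }

  open PartialOrderReasoning poset public hiding (stop)

  x≤y+x : ∀ {x y} → 0# ≤ y → x ≤ y + x
  x≤y+x {x} {y} 0≤y = begin
    x       ≈⟨ +-identityˡ x ⟨
    0# + x  ≤⟨ +-mono-≤ 0≤y ≤-refl ⟩
    y + x   ∎

  0≤+ : ∀ {x y} → 0# ≤ x → 0# ≤ y → 0# ≤ x + y
  0≤+ 0≤x 0≤y = ≤-trans 0≤y (x≤y+x 0≤x)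

  -- If 1 ≤ 0, then 0 ≤ -1, whose square 1 is nonnegative.
  1≰0 : ¬ 1# ≤ 0#
  1≰0 1≤0 = 0≉1 (antisym 0≤1 1≤0)
    where
    0≤-1 : 0# ≤ - 1#
    0≤-1 = begin
      0#         ≈⟨ -‿inverseʳ 1# ⟨
      1# + - 1#  ≤⟨ +-mono-≤ 1≤0 ≤-refl ⟩
      0# + - 1#  ≈⟨ +-identityˡ (- 1#) ⟩
      - 1#       ∎
    0≤1 : 0# ≤ 1#
    0≤1 = begin
      0#           ≤⟨ *-nonNeg 0≤-1 0≤-1 ⟩
      - 1# * - 1#  ≈⟨ -1*x≈-x (- 1#) ⟩
      - (- 1#)     ≈⟨ -‿involutive 1# ⟩
      1#           ∎

  0≤1 : 0# ≤ 1#
  0≤1 with total 0# 1#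
  ... | inj₁ 0≤1 = 0≤1
  ... | inj₂ 1≤0 = contradiction 1≤0 1≰0

  0<2 : 0# < 1# + 1#
  0<2 = 0≤+ 0≤1 0≤1 , λ 0≈2 → 1≰0 (≤-trans (x≤y+x 0≤1) (≤-reflexive (sym 0≈2)))

-- Stars

-- Vertex zero is the centre; the others are leaves.
data Spoke {m : ℕ} : Rel (Fin (suc m)) 0ℓ where
  outward : ∀ {i} → Spoke zero (suc i)
  inward  : ∀ {i} → Spoke (suc i) zero

module _ {c ℓ₁ ℓ₂} (F : OrderedField c ℓ₁ ℓ₂) where
  open OrderedField F
  open FieldProperties F

  module Star {m : ℕ} (radius : Fin m → Carrier) (radius-pos : ∀ i → 0# < radius i) where

    -- Distance from the centre.
    depth : Fin (suc m) → Carrier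
    depth zero    = 0#
    depth (suc i) = radius i

    depth-nonneg : ∀ v → 0# ≤ depth v
    depth-nonneg zero    = ≤-refl
    depth-nonneg (suc i) = proj₁ (radius-pos i)

    -- One end of a spoke is the centre, at depth zero, so the sum of the depths
    -- of both ends is the radius of the leaf.
    star : Graph F (suc m)
    star = record
      { Adj        = Spoke
      ; adj?       = spoke?
      ; adj-sym    = λ { outward → inward ; inward → outward }
      ; adj-irrefl = λ { ≡.refl () }
      ; connected  = walk
      ; weight     = λ v u → depth v + depth u
      ; weight-sym = λ {v} {u} _ → +-comm (depth v) (depth u)
      ; weight-pos = positive
      }
      where
      spoke? : ∀ v u → _
      spoke? zero    zero    = no λ ()
      spoke? zero    (suc _) = yes outward
      spoke? (suc _) zero    = yes inward
      spoke? (suc _) (suc _) = no λ ()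

      walk : ∀ v u → Walk Spoke v u
      walk zero    zero    = stop
      walk zero    (suc j) = step _ outward stop
      walk (suc i) zero    = step _ inward stop
      walk (suc i) (suc j) = step _ inward (step _ outward stop)

      positive : ∀ {v u} → Spoke v u → 0# < depth v + depth u
      positive (outward {i}) = 0≤+ ≤-refl (proj₁ (radius-pos i)) ,
        λ 0≈ → proj₂ (radius-pos i) (trans 0≈ (+-identityˡ _))
      positive (inward {i})  = 0≤+ (proj₁ (radius-pos i)) ≤-refl ,
        λ 0≈ → proj₂ (radius-pos i) (trans 0≈ (+-identityʳ _))

    open Graph star using (len; IsDistance)

    len-nonneg : ∀ {v t} (p : Walk Spoke v t) → 0# ≤ len p
    len-nonneg stop = ≤-refl
    len-nonneg {v} (step u _ p) =
      0≤+ (0≤+ (depth-nonneg v) (depth-nonneg u)) (len-nonneg p)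

    -- A path through the centre is a shortest one between distinct vertices, so
    -- the distance is the sum of the depths.
    depths≤len : ∀ {v t} → v ≢ t → (p : Walk Spoke v t) → depth v + depth t ≤ len p
    depths≤len v≢t stop = contradiction ≡.refl v≢t
    depths≤len {v} {t} v≢t (step u _ p) with u ≟ t
    ... | yes ≡.refl = begin
      depth v + depth u          ≈⟨ +-identityʳ _ ⟨
      depth v + depth u + 0#     ≤⟨ +-mono-≤ ≤-refl (len-nonneg p) ⟩
      depth v + depth u + len p  ∎
    ... | no u≢t = begin
      depth v + depth t              ≤⟨ +-mono-≤ ≤-refl (x≤y+x (depth-nonneg u)) ⟩
      depth v + (depth u + depth t)  ≤⟨ +-mono-≤ ≤-refl (depths≤len u≢t p) ⟩
      depth v + len p                ≤⟨ +-mono-≤ ≤-refl (x≤y+x (depth-nonneg u)) ⟩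
      depth v + (depth u + len p)    ≈⟨ +-assoc _ _ _ ⟨
      depth v + depth u + len p      ∎

    distance-self : ∀ v → IsDistance v v 0#
    distance-self v = ((stop , [] ∷ []) , refl) , λ (p , _) → len-nonneg p

    distance-distinct : ∀ {v t} → v ≢ t → IsDistance v t (depth v + depth t)
    distance-distinct {v} {t} v≢t = shortest v t v≢t , λ (p , _) → depths≤len v≢t p
      where
      shortest : ∀ v t → v ≢ t →
                 ∃[ p ] Graph.pathLength star {v} {t} p ≈ depth v + depth t
      shortest zero    zero    v≢t = contradiction ≡.refl v≢t
      shortest zero    (suc j) v≢t =
        (step _ outward stop , (v≢t ∷ []) ∷ [] ∷ []) , +-identityʳ _
      shortest (suc i) zero    v≢t =
        (step _ inward stop , (v≢t ∷ []) ∷ [] ∷ []) , +-identityʳ _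
      shortest (suc i) (suc j) v≢t =
        (step _ inward (step _ outward stop) ,
          ((λ ()) ∷ v≢t ∷ []) ∷ ((λ ()) ∷ []) ∷ [] ∷ []) ,
        +-cong (+-identityʳ _) (trans (+-identityʳ _) (+-identityˡ _))

  module DecoyStar (ε : Carrier) (0<ε : 0# < ε) where

    -- Leaf zero is the decoy.
    radius : ∀ {m} → Fin m → Carrier
    radius zero    = ε
    radius (suc _) = 1# + 1#

    radius-pos : ∀ {m} (i : Fin m) → 0# < radius i
    radius-pos zero    = 0<ε
    radius-pos (suc _) = 0<2

    open module S {m} = Star {m} radius radius-pos

    -- A star without leaves has no decoy.  The value there plays no role, as its only
    -- vertex is the target.
    decoy : ∀ {m} → Fin (suc m)
    decoy {zero}  = zero
    decoy {suc m} = suc zero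

    -- The vertex to which the adversary points, whatever the target.
    pointer : ∀ {m} → Fin (suc m) → Fin (suc m)
    pointer zero    = decoy
    pointer (suc i) = zero

    exact-within-factor : ∀ {x d} → 0# ≤ d → x ≈ d → x ≤ (1# + ε) * d
    exact-within-factor {x} {d} 0≤d x≈d = begin
      x             ≈⟨ x≈d ⟩
      d             ≤⟨ x≤y+x (*-nonNeg (proj₁ 0<ε) 0≤d) ⟩
      ε * d + d     ≈⟨ solve 2 (λ e y → e :* y :+ y := (con 1 :+ e) :* y) refl ε d ⟩
      (1# + ε) * d  ∎
      where open SemiringSolver commutativeSemiring using (solve; con; _:=_; _:+_; _:*_)

    -- The left-hand side is the weight of the decoy's spoke plus the distance from
    -- the decoy to another leaf; the 0# are depths of the centre.
    detour : 0# + ε + (ε + (1# + 1#)) ≈ (1# + ε) * (0# + (1# + 1#))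
    detour = solve 1 (λ e → con 0 :+ e :+ (e :+ (con 1 :+ con 1))
                         := (con 1 :+ e) :* (con 0 :+ (con 1 :+ con 1))) refl ε
      where open SemiringSolver commutativeSemiring using (solve; con; _:=_; _:+_; _:*_)

    depths-nonneg : ∀ {m} (v t : Fin (suc m)) → 0# ≤ depth v + depth t
    depths-nonneg v t = 0≤+ (depth-nonneg v) (depth-nonneg t)

    reply-legal : ∀ {m} {t v : Fin (suc m)} → v ≢ t →
                  Legal F star ε t v (toward (pointer v))
    reply-legal {t = zero} {zero} v≢t = contradiction ≡.refl v≢t
    reply-legal {t = zero} {suc i} v≢t =
      toward v≢t inward (distance-self _) (distance-distinct v≢t)
        (exact-within-factor (depths-nonneg (suc i) zero) (+-identityʳ _))
    reply-legal {t = suc j} {suc i} v≢t =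
      toward v≢t inward (distance-distinct λ ()) (distance-distinct v≢t)
        (exact-within-factor (depths-nonneg (suc i) (suc j))
          (+-cong (+-identityʳ _) (+-identityˡ _)))
    reply-legal {t = suc zero} {zero} v≢t =
      toward v≢t outward (distance-self _) (distance-distinct v≢t)
        (exact-within-factor (0≤+ ≤-refl (proj₁ 0<ε)) (+-identityʳ _))
    reply-legal {t = suc (suc j)} {zero} v≢t =
      toward v≢t outward (distance-distinct λ ()) (distance-distinct v≢t)
        (≤-reflexive detour)

theorem2 : ∀ {c ℓ₁ ℓ₂} (F : OrderedField c ℓ₁ ℓ₂) → let open OrderedField F in
    ∀ (n : ℕ) (ε : Carrier) → 0# < ε →
    fromℕ n * (ε / fromℕ 4) ≤ fromℕ n - 1# →
    Σ[ G ∈ Graph F n ] (∀ (alg : Algorithm n) → Detects F G ε alg →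
    ∃[ t ] ∃[ h ] (Reachable F G ε alg t h × fromℕ n * (ε / fromℕ 4) ≤ fromℕ (length h)))
-- Without vertices, the bound would read 0 ≤ -1.
theorem2 F zero ε 0<ε bound = ⊥-elim (1≰0 (begin
  1#                       ≈⟨ +-identityʳ 1# ⟨
  1# + 0#                  ≈⟨ +-congˡ (zeroˡ _) ⟨
  1# + 0# * (ε / fromℕ 4)  ≤⟨ +-mono-≤ ≤-refl bound ⟩
  1# + (0# - 1#)           ≈⟨ +-congˡ (+-identityˡ _) ⟩
  1# - 1#                  ≈⟨ -‿inverseʳ 1# ⟩
  0#                       ∎))
  where
  open OrderedField F
  open FieldProperties F
  open CommutativeRing commutativeRing using (zeroˡ)
theorem2 F (suc m) ε 0<ε bound = star , forced
  where
  open OrderedField F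
  open FieldProperties F
  open DecoyStar F ε 0<ε
  open Star F {m} radius radius-pos using (star)

  cancel : fromℕ (suc m) - 1# ≈ fromℕ m
  cancel = begin-equality
    1# + fromℕ m - 1#    ≈⟨ +-congʳ (+-comm 1# (fromℕ m)) ⟩
    fromℕ m + 1# - 1#    ≈⟨ +-assoc _ _ _ ⟩
    fromℕ m + (1# - 1#)  ≈⟨ +-congˡ (-‿inverseʳ 1#) ⟩
    fromℕ m + 0#         ≈⟨ +-identityʳ _ ⟩
    fromℕ m              ∎

  forced : ∀ alg → Detects F star ε alg →
           ∃[ t ] ∃[ h ] (Reachable F star ε alg t h ×
                          fromℕ (suc m) * (ε / fromℕ 4) ≤ fromℕ (length h))
  forced alg detects
    with oblivious-adversary F star ε alg (λ v → toward (pointer v)) reply-legal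
           detects m (ℕ.n<1+n m)
  ... | h , Q , ∣h∣≡m , ∣Q∣≡m , reachable
    with missing-element Q (ℕ.≤-reflexive (≡.cong suc ∣Q∣≡m))
  ...   | t , t∉Q = t , h , reachable t t∉Q , (begin
    fromℕ (suc m) * (ε / fromℕ 4)  ≤⟨ bound ⟩
    fromℕ (suc m) - 1#             ≈⟨ cancel ⟩
    fromℕ m                        ≡⟨ ≡.cong fromℕ ∣h∣≡m ⟨
    fromℕ (length h)               ∎)
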